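{- For every circular arc graph $G$, $\operatorname{box}(G)\le 2\omega(G)+1\le 2\Delta(G)+3$.
   Context: A graph $G$ is a circular arc graph if its vertices can be put in one-to-one correspondence with a set of arcs of a circle so that two vertices are adjacent iff their arcs intersect. $\omega(G)$ is the clique number and $\Delta(G)$ the maximum degree. The boxicity $\operatorname{box}(G)$ is the minimum $b$ such that $G$ is the intersection graph of axis-parallel boxes in $\mathbb{R}^b$ (products of $b$ closed intervals), one box per vertex. -}

module Defs where

open import Data.Fin using (Fin)
open import Data.Fin.Properties using (_≟_; all?)
open import Data.Fin.Subset using (Subset; _∈_; ∣_∣)
open import Data.Fin.Subset.Properties using (_∈?_; anySubset?)
open import Data.Integer using (ℤ)
open import Data.List using (map; filter; length; allFin; upTo)
open import Data.List.Extrema.Nat using (max)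
open import Data.Nat using (ℕ; suc)
import Data.Nat as ℕ
open import Data.Product using (Σ; ∃; _×_; _,_)
open import Data.Rational using (ℚ; _+_; _-_; -_; _<_; _/_; 1ℚ)
open import Data.Rational.Properties using (+-monoˡ-<; +-0-group)
open import Data.Sum using (_⊎_)
open import Data.Vec.Functional using (Vector)
open import Function using (_⇔_; mk⇔; Equivalence)
open import Level using (0ℓ)
open import Relation.Binary.Core using (Rel)
import Relation.Binary.Definitions as Binary
open import Relation.Binary.PropositionalEquality using (_≡_; _≢_; sym; subst)
open import Relation.Nullary using (¬_; Dec; ¬?; _×-dec_; _→-dec_)
open import Relation.Unary using (Pred; _≬_; _≐_)
import Algebra.Properties.Group +-0-group as ℚ-Group

-- Dedekind reals: two-sided located cuts of ℚ.

record ℝ : Set₁ where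
  field
    lower upper     : Pred ℚ 0ℓ
    lower-inhabited : ∃ lower
    upper-inhabited : ∃ upper
    lower-rounded   : ∀ {q} → lower q ⇔ (∃ λ r → q < r × lower r)
    upper-rounded   : ∀ {q} → upper q ⇔ (∃ λ r → r < q × upper r)
    disjoint        : ∀ {q} → ¬ (lower q × upper q)
    located         : ∀ {q r} → q < r → lower q ⊎ upper r

open ℝ public

infix 4 _≤_
_≤_ : Rel ℝ 0ℓ
x ≤ y = ∀ {q} → lower x q → lower y q

-- Translation of a real by a rational: q < x + c iff q - c < x.

infixl 6 _⊕_
_⊕_ : ℝ → ℚ → ℝ
x ⊕ c = record
  { lower           = λ q → lower x (q - c)
  ; upper           = λ q → upper x (q - c)
  ; lower-inhabited = let (q , l) = lower-inhabited x in q + c , subst (lower x) (cancel q) l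
  ; upper-inhabited = let (q , u) = upper-inhabited x in q + c , subst (upper x) (cancel q) u
  ; lower-rounded   = λ {q} → mk⇔
      (λ l → let (r , q-c<r , l′) = Equivalence.to (lower-rounded x) l in
        r + c , subst (_< r + c) (restore q) (+-monoˡ-< c q-c<r) , subst (lower x) (cancel r) l′)
      (λ (r , q<r , l) →
        Equivalence.from (lower-rounded x) (r - c , +-monoˡ-< (- c) q<r , l))
  ; upper-rounded   = λ {q} → mk⇔
      (λ u → let (r , r<q-c , u′) = Equivalence.to (upper-rounded x) u in
        r + c , subst (r + c <_) (restore q) (+-monoˡ-< c r<q-c) , subst (upper x) (cancel r) u′)
      (λ (r , r<q , u) →
        Equivalence.from (upper-rounded x) (r - c , +-monoˡ-< (- c) r<q , u))
  ; disjoint        = disjoint x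
  ; located         = λ q<r → located x (+-monoˡ-< (- c) q<r)
  }
  where
  cancel : ∀ q → q ≡ q + c - c
  cancel q = sym (ℚ-Group.//-rightDividesʳ c q)

  restore : ∀ q → q - c + c ≡ q
  restore q = ℚ-Group.//-rightDividesˡ c q

-- Finite simple graphs on n vertices.  Decidability of adjacency makes the
-- clique number and the maximum degree computable.

record Graph (n : ℕ) : Set₁ where
  field
    Adj    : Rel (Fin n) 0ℓ
    adj?   : Binary.Decidable Adj
    symm   : Binary.Symmetric Adj
    irrefl : ∀ {u} → ¬ Adj u u

open Graph public

IsClique : ∀ {n} → Graph n → Subset n → Set
IsClique G S = ∀ u v → u ∈ S → v ∈ S → u ≢ v → Adj G u v

HasClique : ∀ {n} → Graph n → ℕ → Set
HasClique {n} G k = ∃ λ (S : Subset n) → ∣ S ∣ ≡ k × IsClique G S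

isClique? : ∀ {n} (G : Graph n) (S : Subset n) → Dec (IsClique G S)
isClique? G S = all? λ u → all? λ v →
  (u ∈? S) →-dec ((v ∈? S) →-dec (¬? (u ≟ v) →-dec adj? G u v))

hasClique? : ∀ {n} (G : Graph n) (k : ℕ) → Dec (HasClique G k)
hasClique? G k = anySubset? λ S → (∣ S ∣ ℕ.≟ k) ×-dec isClique? G S

-- The largest clique size; sizes range over 0, …, n.

ω : ∀ {n} → Graph n → ℕ
ω {n} G = max 0 (filter (hasClique? G) (upTo (suc n)))

degree : ∀ {n} → Graph n → Fin n → ℕ
degree {n} G u = length (filter (adj? G u) (allFin n))

-- The graph without vertices gets Δ = 0.

Δ : ∀ {n} → Graph n → ℕ
Δ {n} G = max 0 (map (degree G) (allFin n))

-- Two distinct vertices are adjacent iff their sets share a point.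

IsIntersectionGraph : ∀ {n} {X : Set₁} → Graph n → (Fin n → Pred X 0ℓ) → Set₁
IsIntersectionGraph G F = ∀ {u v} → u ≢ v → Adj G u v ⇔ (F u ≬ F v)

-- The circle is ℝ/ℤ, a real standing for its class modulo ℤ.  A closed arc is
-- the image of a closed interval [start , end] of length at most 1.

record Arc : Set₁ where
  field
    start end   : ℝ
    start≤end   : start ≤ end
    end≤start+1 : end ≤ start ⊕ 1ℚ

open Arc public

arcPoints : Arc → Pred ℝ 0ℓ
arcPoints A p = ∃ λ (k : ℤ) → start A ≤ p ⊕ (k / 1) × p ⊕ (k / 1) ≤ end A

-- The first component says that distinct vertices receive distinct arcs.

IsCircularArcGraph : ∀ {n} → Graph n → Set₁
IsCircularArcGraph {n} G = Σ (Fin n → Arc) λ arc →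
  (∀ {u v} → arcPoints (arc u) ≐ arcPoints (arc v) → u ≡ v)
  × IsIntersectionGraph G (λ v → arcPoints (arc v))

record Interval : Set₁ where
  field
    lo hi : ℝ
    lo≤hi : lo ≤ hi

open Interval public

Box : ℕ → Set₁
Box b = Vector Interval b

boxPoints : ∀ {b} → Box b → Pred (Vector ℝ b) 0ℓ
boxPoints B p = ∀ i → lo (B i) ≤ p i × p i ≤ hi (B i)

HasBoxRepresentation : ∀ {n} → Graph n → ℕ → Set₁
HasBoxRepresentation {n} G b = Σ (Fin n → Box b) λ box →
  IsIntersectionGraph G (λ v → boxPoints (box v))

-- box(G) = b.  Dimension 0 is allowed: ℝ⁰ is a single point, so exactly the
-- complete graphs have boxicity 0.

IsBoxicity : ∀ {n} → Graph n → ℕ → Set₁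
IsBoxicity G b =
  HasBoxRepresentation G b × (∀ c → HasBoxRepresentation G c → b ℕ.≤ c)

{-# OPTIONS --safe #-}

-- The arcs through the point 0 of the circle form a clique K, so |K| ≤ ω(G).
-- Cut at 0, the remaining arcs become intervals of the open unit interval, so
-- G − K is an interval graph and needs one coordinate.  One further coordinate
-- per w ∈ K separates w from its non-neighbours, giving box(G) ≤ ω(G) + 1.
--
-- Constructively, order relations between reals are undecidable, but whether G
-- has a realizer by c interval orders is decidable, and such a realizer is, up
-- to double negation, the same as a box representation in dimension c.  Hence
-- the argument above may use excluded middle for the finitely many comparisons
-- involved, and the least dimension can be found by search.

module Submission where

open import Defs using (ℝ; lower; upper; lower-inhabited; upper-inhabited; lower-rounded; upper-rounded; disjoint; located; _⊕_)
open import Defs using (Graph; Adj; adj?; symm; IsClique; hasClique?; ω; Δ; degree)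
open import Defs using (start; end; start≤end; arcPoints; IsCircularArcGraph)
open import Defs using (Interval; lo; hi; lo≤hi; boxPoints; HasBoxRepresentation; IsBoxicity)
open import Algebra.Properties.AbelianGroup using (//-rightDividesˡ)
open import Data.Fin as Fin using (Fin; zero; suc)
import Data.Fin.Properties as Fin
open import Data.Fin.Subset as Subset using (Subset; _∈_; ∣_∣; inside; outside; _∪_; ⁅_⁆)
import Data.Fin.Subset.Properties as Subset
open import Data.Integer as ℤ using (ℤ; +_; 1ℤ)
import Data.Integer.Properties as ℤ
open import Data.Integer.Tactic.RingSolver using (solve-∀)
open import Data.List as List using (List; filter; allFin; length; upTo)
open import Data.List.Extrema.Nat using (max; xs≤max; max≤v⁺; max<v⁺)
import Data.List.Membership.Propositional.Properties as List
import Data.List.Relation.Unary.All as All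
import Data.List.Relation.Unary.All.Properties as All
import Data.List.Relation.Unary.Any as Any
import Data.List.Relation.Unary.Any.Properties as Any
open import Data.Nat as ℕ using (ℕ; zero; suc; _+_; _*_; _≤_; _<_; _⊔_; s≤s; z≤n)
open import Data.Nat.Induction using (<-rec)
import Data.Nat.Properties as ℕ
open import Data.Product using (∃; _×_; _,_; proj₁; proj₂)
open import Data.Rational as ℚ using (ℚ; 0ℚ; 1ℚ; _/_)
import Data.Rational.Properties as ℚ
import Data.Rational.Unnormalised as ℚᵘ
import Data.Rational.Unnormalised.Properties as ℚᵘ
open import Data.Sum as Sum using (_⊎_; inj₁; inj₂; [_,_]′)
open import Data.Vec as Vec using (Vec; []; _∷_)
import Data.Vec.Properties as Vec
open import Effect.Monad using (RawMonad)
open import Function using (_⇔_; mk⇔; Equivalence; _∘_; id)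
open import Level using (0ℓ)
open import Relation.Binary.Core using (Rel)
import Relation.Binary.Definitions as Binary
open import Relation.Binary.PropositionalEquality using (_≡_; _≢_; refl; sym; trans; cong; cong₂; subst; subst₂; module ≡-Reasoning)
import Relation.Binary.Reasoning.Base.Single
open import Relation.Nullary using (¬_; Dec; yes; no; does; contradiction; ¬?; _×-dec_; _⊎-dec_; _→-dec_)
open import Relation.Nullary.Decidable using (decidable-stable; dec-true; map′; ¬¬-excluded-middle)
open import Relation.Nullary.Negation using (¬¬-Monad)
open import Relation.Unary using (Pred; Decidable; _≬_)

open Equivalence using (to; from)

-- Dedekind reals

-- The order of ℝ wrapped in a record: from x Defs.≤ y, which unfolds to a
-- statement about cuts, x and y cannot be inferred.

infix 4 _⊑_
record _⊑_ (x y : ℝ) : Set where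
  constructor ⟪_⟫
  field lower-⊆ : x Defs.≤ y

open _⊑_

⊑-refl : ∀ {x} → x ⊑ x
⊑-refl = ⟪ (λ l → l) ⟫

⊑-trans : ∀ {x y z} → x ⊑ y → y ⊑ z → x ⊑ z
⊑-trans x⊑y y⊑z = ⟪ (λ l → lower-⊆ y⊑z (lower-⊆ x⊑y l)) ⟫

lower-downward : ∀ (x : ℝ) {q r} → q ℚ.≤ r → lower x r → lower x q
lower-downward x q≤r l =
  let (s , r<s , l′) = to (lower-rounded x) l in
  from (lower-rounded x) (s , ℚ.≤-<-trans q≤r r<s , l′)

lower<upper : ∀ (x : ℝ) {q r} → lower x q → upper x r → q ℚ.< r
lower<upper x {q} {r} l u with ℚ._<?_ q r
... | yes q<r = q<r
... | no q≮r = contradiction (lower-downward x (ℚ.≮⇒≥ q≮r) l , u) (disjoint x)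

-- Choose `r` above `q` but still below `y`. Locating `x` against `q < r` either gives the claim or
-- puts `x` below `r`, hence below `y`, which is excluded.
⋢⇒⊒ : ∀ {x y} → ¬ x ⊑ y → y ⊑ x
⋢⇒⊒ {x} {y} x⋢y = ⟪ (λ {q} l →
  let (r , q<r , l′) = to (lower-rounded y) l in
  [ (λ x∋q → x∋q)
  , (λ u → contradiction ⟪ (λ m → lower-downward y (ℚ.<⇒≤ (lower<upper x m u)) l′) ⟫ x⋢y)
  ]′ (located x q<r)) ⟫

¬¬⊑-total : ∀ x y → ¬ ¬ (x ⊑ y ⊎ y ⊑ x)
¬¬⊑-total x y ¬total = ¬total (inj₂ (⋢⇒⊒ (¬total ∘ inj₁)))

fromℚ : ℚ → ℝ
fromℚ p = record
  { lower           = ℚ._< p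
  ; upper           = p ℚ.<_
  ; lower-inhabited = p ℚ.- 1ℚ ,
      subst (p ℚ.- 1ℚ ℚ.<_) (ℚ.+-identityʳ p) (ℚ.+-monoʳ-< p {ℚ.- 1ℚ} {0ℚ} (ℚ.*<* ℤ.-<+))
  ; upper-inhabited = p ℚ.+ 1ℚ ,
      subst (ℚ._< p ℚ.+ 1ℚ) (ℚ.+-identityʳ p)
        (ℚ.+-monoʳ-< p {0ℚ} {1ℚ} (ℚ.*<* (ℤ.+<+ ℕ.z<s)))
  ; lower-rounded   = mk⇔ ℚ.<-dense (λ (_ , q<r , r<p) → ℚ.<-trans q<r r<p)
  ; upper-rounded   = mk⇔
      (λ p<q → let (r , p<r , r<q) = ℚ.<-dense p<q in r , r<q , p<r)
      (λ (_ , r<q , p<r) → ℚ.<-trans p<r r<q)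
  ; disjoint        = λ (q<p , p<q) → ℚ.<-asym q<p p<q
  ; located         = located′
  }
  where
  located′ : ∀ {q r} → q ℚ.< r → q ℚ.< p ⊎ p ℚ.< r
  located′ {q} {r} q<r with ℚ._<?_ q p
  ... | yes q<p = inj₁ q<p
  ... | no q≮p = inj₂ (ℚ.≤-<-trans (ℚ.≮⇒≥ q≮p) q<r)

-- Integers inside the rationals and integer translations of reals

toℚᵘ-/1 : ∀ k → ℚ.toℚᵘ (k / 1) ℚᵘ.≃ ℚᵘ.mkℚᵘ k 0
toℚᵘ-/1 k = ℚ.toℚᵘ-fromℚᵘ (ℚᵘ.mkℚᵘ k 0)

/1-homo-+ : ∀ k l → (k ℤ.+ l) / 1 ≡ k / 1 ℚ.+ l / 1
/1-homo-+ k l = ℚ.toℚᵘ-injective (begin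
  ℚ.toℚᵘ ((k ℤ.+ l) / 1)               ≈⟨ toℚᵘ-/1 (k ℤ.+ l) ⟩
  ℚᵘ.mkℚᵘ (k ℤ.+ l) 0                  ≡⟨ cong₂ (λ a b → ℚᵘ.mkℚᵘ (a ℤ.+ b) 0) (ℤ.*-identityʳ k) (ℤ.*-identityʳ l) ⟨
  ℚᵘ.mkℚᵘ k 0 ℚᵘ.+ ℚᵘ.mkℚᵘ l 0         ≈⟨ ℚᵘ.+-cong (toℚᵘ-/1 k) (toℚᵘ-/1 l) ⟨
  ℚ.toℚᵘ (k / 1) ℚᵘ.+ ℚ.toℚᵘ (l / 1)   ≈⟨ ℚ.toℚᵘ-homo-+ (k / 1) (l / 1) ⟨
  ℚ.toℚᵘ (k / 1 ℚ.+ l / 1)             ∎)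
  where open ℚᵘ.≃-Reasoning

/1-mono-≤ : ∀ {k l} → k ℤ.≤ l → k / 1 ℚ.≤ l / 1
/1-mono-≤ {k} {l} k≤l = ℚ.toℚᵘ-cancel-≤ (begin
  ℚ.toℚᵘ (k / 1)   ≃⟨ toℚᵘ-/1 k ⟩
  ℚᵘ.mkℚᵘ k 0      ≤⟨ ℚᵘ.*≤* (ℤ.*-monoʳ-≤-nonNeg 1ℤ k≤l) ⟩
  ℚᵘ.mkℚᵘ l 0      ≃⟨ toℚᵘ-/1 l ⟨
  ℚ.toℚᵘ (l / 1)   ∎)
  where open ℚᵘ.≤-Reasoning

/1-mono-< : ∀ {k l} → k ℤ.< l → k / 1 ℚ.< l / 1
/1-mono-< {k} {l} k<l = ℚ.toℚᵘ-cancel-< (begin-strict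
  ℚ.toℚᵘ (k / 1)   ≃⟨ toℚᵘ-/1 k ⟩
  ℚᵘ.mkℚᵘ k 0      <⟨ ℚᵘ.*<* (ℤ.*-monoʳ-<-pos 1ℤ k<l) ⟩
  ℚᵘ.mkℚᵘ l 0      ≃⟨ toℚᵘ-/1 l ⟨
  ℚ.toℚᵘ (l / 1)   ∎)
  where open ℚᵘ.≤-Reasoning

minus-/1-+ : ∀ q k l → q ℚ.- l / 1 ℚ.- k / 1 ≡ q ℚ.- (k ℤ.+ l) / 1
minus-/1-+ q k l = begin
  q ℚ.- l / 1 ℚ.- k / 1              ≡⟨ ℚ.+-assoc q _ _ ⟩
  q ℚ.+ (ℚ.- (l / 1) ℚ.- k / 1)      ≡⟨ cong (q ℚ.+_) (ℚ.+-comm (ℚ.- (l / 1)) _) ⟩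
  q ℚ.+ (ℚ.- (k / 1) ℚ.- l / 1)      ≡⟨ cong (q ℚ.+_) (ℚ.neg-distrib-+ (k / 1) (l / 1)) ⟨
  q ℚ.- (k / 1 ℚ.+ l / 1)            ≡⟨ cong (λ r → q ℚ.- r) (/1-homo-+ k l) ⟨
  q ℚ.- (k ℤ.+ l) / 1                ∎
  where open ≡-Reasoning

minus-/1-cancel : ∀ q k → q ℚ.- k / 1 ℚ.- (ℤ.- k) / 1 ≡ q
minus-/1-cancel q k = begin
  q ℚ.- k / 1 ℚ.- (ℤ.- k) / 1   ≡⟨ minus-/1-+ q (ℤ.- k) k ⟩
  q ℚ.- (ℤ.- k ℤ.+ k) / 1       ≡⟨ cong (λ j → q ℚ.- j / 1) (ℤ.+-inverseˡ k) ⟩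
  q ℚ.+ 0ℚ                      ≡⟨ ℚ.+-identityʳ q ⟩
  q                             ∎
  where open ≡-Reasoning

0ℝ : ℝ
0ℝ = fromℚ 0ℚ

infixl 6 _⊞_
opaque
  _⊞_ : ℝ → ℤ → ℝ
  x ⊞ k = x ⊕ (k / 1)

  ⊞-monoˡ : ∀ {x y} k → x ⊑ y → x ⊞ k ⊑ y ⊞ k
  ⊞-monoˡ k x⊑y = ⟪ (λ l → lower-⊆ x⊑y l) ⟫

  ⊞-monoʳ : ∀ x {k l} → k ℤ.≤ l → x ⊞ k ⊑ x ⊞ l
  ⊞-monoʳ x k≤l =
    ⟪ (λ {q} → lower-downward x (ℚ.+-monoʳ-≤ q (ℚ.neg-antimono-≤ (/1-mono-≤ k≤l)))) ⟫

  ⊞-assoc-⊑ : ∀ x k l → x ⊞ k ⊞ l ⊑ x ⊞ (k ℤ.+ l)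
  ⊞-assoc-⊑ x k l = ⟪ (λ {q} → subst (lower x) (minus-/1-+ q k l)) ⟫

  ⊞-assoc-⊒ : ∀ x k l → x ⊞ (k ℤ.+ l) ⊑ x ⊞ k ⊞ l
  ⊞-assoc-⊒ x k l = ⟪ (λ {q} → subst (lower x) (sym (minus-/1-+ q k l))) ⟫

  ⊞-cancel-⊑ : ∀ x k → x ⊞ ℤ.- k ⊞ k ⊑ x
  ⊞-cancel-⊑ x k = ⟪ (λ {q} → subst (lower x) (minus-/1-cancel q k)) ⟫

  ⊞-cancel-⊒ : ∀ x k → x ⊑ x ⊞ ℤ.- k ⊞ k
  ⊞-cancel-⊒ x k = ⟪ (λ {q} → subst (lower x) (sym (minus-/1-cancel q k))) ⟫

  lower-0⊞ : ∀ k {q} → lower (0ℝ ⊞ k) q ⇔ q ℚ.< k / 1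
  lower-0⊞ k {q} = mk⇔
    (λ q-k<0 → subst₂ ℚ._<_ (//-rightDividesˡ ℚ.+-0-abelianGroup (k / 1) q)
      (ℚ.+-identityˡ (k / 1)) (ℚ.+-monoˡ-< (k / 1) q-k<0))
    (λ q<k → subst (q ℚ.- k / 1 ℚ.<_) (ℚ.+-inverseʳ (k / 1)) (ℚ.+-monoˡ-< (ℚ.- (k / 1)) q<k))

  -- Outside the opaque block `_⊞_` does not unfold; these four conversions tie it to `_⊕_`, in
  -- which arcs are defined.
  ⊑-⊞⁺ : ∀ {x y k} → x Defs.≤ y ⊕ (k / 1) → x ⊑ y ⊞ k
  ⊑-⊞⁺ l = ⟪ l ⟫

  ⊑-⊞⁻ : ∀ {x y k} → x ⊑ y ⊞ k → x Defs.≤ y ⊕ (k / 1)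
  ⊑-⊞⁻ = lower-⊆

  ⊞-⊑⁺ : ∀ {x y k} → x ⊕ (k / 1) Defs.≤ y → x ⊞ k ⊑ y
  ⊞-⊑⁺ l = ⟪ l ⟫

  ⊞-⊑⁻ : ∀ {x y k} → x ⊞ k ⊑ y → x ⊕ (k / 1) Defs.≤ y
  ⊞-⊑⁻ = lower-⊆

-- For `l < k` the rational `l / 1` would lie strictly below the integer `l`.
0⊞-cancel : ∀ {k l} → 0ℝ ⊞ k ⊑ 0ℝ ⊞ l → k ℤ.≤ l
0⊞-cancel {k} {l} k⊑l = ℤ.≮⇒≥ λ l<k → ℚ.<-irrefl refl
  (to (lower-0⊞ l) (lower-⊆ k⊑l {l / 1} (from (lower-0⊞ k) (/1-mono-< l<k))))

ℚ-bounded : ∀ p → ∃ λ N → (ℤ.- + N) / 1 ℚ.≤ p × p ℚ.≤ (+ N) / 1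
ℚ-bounded p@(ℚ.mkℚ i d _) = N , ℚ.toℚᵘ-cancel-≤ (begin
    ℚ.toℚᵘ ((ℤ.- + N) / 1)   ≃⟨ toℚᵘ-/1 (ℤ.- + N) ⟩
    ℚᵘ.mkℚᵘ (ℤ.- + N) 0      ≤⟨ ℚᵘ.*≤* below ⟩
    ℚ.toℚᵘ p                 ∎)
  , ℚ.toℚᵘ-cancel-≤ (begin
    ℚ.toℚᵘ p                 ≤⟨ ℚᵘ.*≤* above ⟩
    ℚᵘ.mkℚᵘ (+ N) 0          ≃⟨ toℚᵘ-/1 (+ N) ⟨
    ℚ.toℚᵘ ((+ N) / 1)       ∎)
  where
  open ℚᵘ.≤-Reasoning
  -- Denominators are at least 1, so the absolute value of the numerator bounds the fraction on both
  -- sides.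
  N = ℤ.∣ i ∣
  i≤∣i∣ : ∀ j → j ℤ.≤ + ℤ.∣ j ∣
  i≤∣i∣ (+ _)      = ℤ.≤-refl
  i≤∣i∣ ℤ.-[1+ _ ] = ℤ.-≤+
  N≤ : + N ℤ.≤ + N ℤ.* + suc d
  N≤ = subst (+ N ℤ.≤_) (ℤ.pos-* N (suc d)) (ℤ.+≤+ (ℕ.m≤m*n N (suc d)))
  above : i ℤ.* 1ℤ ℤ.≤ + N ℤ.* + suc d
  above = subst (ℤ._≤ + N ℤ.* + suc d) (sym (ℤ.*-identityʳ i)) (ℤ.≤-trans (i≤∣i∣ i) N≤)
  below : (ℤ.- + N) ℤ.* + suc d ℤ.≤ i ℤ.* 1ℤ
  below = subst₂ ℤ._≤_ (ℤ.neg-distribˡ-* (+ N) (+ suc d))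
    (trans (ℤ.neg-involutive i) (sym (ℤ.*-identityʳ i)))
    (ℤ.neg-mono-≤ (ℤ.≤-trans (subst (λ m → ℤ.- i ℤ.≤ + m) (ℤ.∣-i∣≡∣i∣ i) (i≤∣i∣ (ℤ.- i))) N≤))

-- Induction on the width `j` of a window around `x`: either its last unit interval contains `x`, or
-- the window shrinks by one.
¬¬floor-within : ∀ x m j → 0ℝ ⊞ m ⊑ x → x ⊑ 0ℝ ⊞ (m ℤ.+ + j) →
  ¬ ¬ ∃ λ k → 0ℝ ⊞ k ⊑ x × x ⊑ 0ℝ ⊞ (k ℤ.+ 1ℤ)
¬¬floor-within x m zero m⊑x x⊑m ¬floor =
  ¬floor (m , m⊑x , ⊑-trans x⊑m (⊞-monoʳ 0ℝ (ℤ.+-monoʳ-≤ m (ℤ.+≤+ (ℕ.z≤n {1})))))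
¬¬floor-within x m (suc j) m⊑x x⊑m+1+j ¬floor =
  ¬¬floor-within x m j m⊑x (⋢⇒⊒ m+j⋢x) ¬floor
  where
  m+j⋢x : ¬ 0ℝ ⊞ (m ℤ.+ + j) ⊑ x
  m+j⋢x m+j⊑x = ¬floor (m ℤ.+ + j , m+j⊑x , subst (λ i → x ⊑ 0ℝ ⊞ i)
    (trans (cong (λ i → m ℤ.+ + i) (ℕ.+-comm 1 j)) (sym (ℤ.+-assoc m (+ j) 1ℤ))) x⊑m+1+j)

¬¬floor : ∀ x → ¬ ¬ ∃ λ k → 0ℝ ⊞ k ⊑ x × x ⊑ 0ℝ ⊞ (k ℤ.+ 1ℤ)
¬¬floor x =
  let (q , l)        = lower-inhabited x
      (r , u)        = upper-inhabited x
      (M , -M≤q , _) = ℚ-bounded q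
      (N , _ , r≤N)  = ℚ-bounded r
  -- The integers `- M ≤ q` and `N ≥ r` enclose `x` in a window of width `M + N`.
  in ¬¬floor-within x (ℤ.- + M) (M ℕ.+ N)
       ⟪ (λ m → lower-downward x (ℚ.<⇒≤ (ℚ.<-≤-trans (to (lower-0⊞ (ℤ.- + M)) m) -M≤q)) l) ⟫
       (subst (λ i → x ⊑ 0ℝ ⊞ i) (-m+[m+n]≡n M N)
         ⟪ (λ m → from (lower-0⊞ (+ N)) (ℚ.<-≤-trans (lower<upper x m u) r≤N)) ⟫)
  where
  -m+[m+n]≡n : ∀ m n → + n ≡ ℤ.- + m ℤ.+ + (m ℕ.+ n)
  -m+[m+n]≡n m n = sym (trans (sym (ℤ.+-assoc (ℤ.- + m) (+ m) (+ n)))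
    (trans (cong (ℤ._+ + n) (ℤ.+-inverseˡ (+ m))) (ℤ.+-identityˡ (+ n))))

-- Double negation commutes with finite products, so a negative goal may assume excluded middle for
-- finitely many propositions at once.
¬¬-∀ : ∀ {n} {P : Pred (Fin n) 0ℓ} → (∀ i → ¬ ¬ P i) → ¬ ¬ (∀ i → P i)
¬¬-∀ = Fin.sequence (RawMonad.rawApplicative ¬¬-Monad)

-- Finite subsets and searches

module _ {n} {P : Pred (Fin n) 0ℓ} (P? : Decidable P) where

  subset : Subset n
  subset = Vec.tabulate (does ∘ P?)

  ∈-subset⁺ : ∀ {u} → P u → u ∈ subset
  ∈-subset⁺ {u} Pu = Vec.lookup⇒[]= u subset
    (trans (Vec.lookup∘tabulate (does ∘ P?) u) (dec-true (P? u) Pu))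

  ∈-subset⁻ : ∀ {u} → u ∈ subset → P u
  ∈-subset⁻ {u} u∈ with P? u | trans (sym (Vec.lookup∘tabulate (does ∘ P?) u)) (Vec.[]=⇒lookup u∈)
  ... | yes Pu | _ = Pu
  ... | no _   | ()

-- Reconciles two ways of counting: filtered lists, as in `degree`, and subsets, as in cliques.
length-filter-tabulate : ∀ {a} {A : Set a} {n} {P : Pred A 0ℓ} (P? : Decidable P) (f : Fin n → A) →
  length (filter P? (List.tabulate f)) ≡ ∣ subset (P? ∘ f) ∣
length-filter-tabulate {n = zero}  P? f = refl
length-filter-tabulate {n = suc n} P? f with P? (f zero)
... | yes _ = cong suc (length-filter-tabulate P? (f ∘ suc))
... | no _  = length-filter-tabulate P? (f ∘ suc)

∣p∪q∣≤∣p∣+∣q∣ : ∀ {n} (p q : Subset n) → ∣ p ∪ q ∣ ≤ ∣ p ∣ + ∣ q ∣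
∣p∪q∣≤∣p∣+∣q∣ []            []            = z≤n
∣p∪q∣≤∣p∣+∣q∣ (outside ∷ p) (outside ∷ q) = ∣p∪q∣≤∣p∣+∣q∣ p q
∣p∪q∣≤∣p∣+∣q∣ (outside ∷ p) (inside ∷ q)  =
  subst (suc ∣ p ∪ q ∣ ≤_) (sym (ℕ.+-suc ∣ p ∣ ∣ q ∣)) (s≤s (∣p∪q∣≤∣p∣+∣q∣ p q))
∣p∪q∣≤∣p∣+∣q∣ (inside ∷ p)  (y ∷ q)       =
  s≤s (ℕ.≤-trans (∣p∪q∣≤∣p∣+∣q∣ p q) (ℕ.+-monoʳ-≤ ∣ p ∣ (Subset.∣p∣≤∣x∷p∣ y q)))

-- Exhaustive search passes from `A` to vectors over `A`; applied twice, it searches matrices of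
-- subsets.
anyVec? : {A : Set} → (∀ {P : Pred A 0ℓ} → Decidable P → Dec (∃ P)) →
  ∀ {n} {P : Pred (Vec A n) 0ℓ} → Decidable P → Dec (∃ P)
anyVec? any? {zero}  P? = map′ ([] ,_) (λ { ([] , p) → p }) (P? [])
anyVec? any? {suc n} P? = map′
  (λ (x , xs , p) → x ∷ xs , p) (λ { (x ∷ xs , p) → x , xs , p })
  (any? λ x → anyVec? any? (P? ∘ (x ∷_)))

-- Clique number and maximum degree

clique≤ω : ∀ {n} (G : Graph n) S → IsClique G S → ∣ S ∣ ≤ ω G
clique≤ω {n} G S clique = All.lookup (xs≤max 0 (filter (hasClique? G) (upTo (suc n))))
  (List.∈-filter⁺ (hasClique? G) (List.∈-upTo⁺ (s≤s (Subset.∣p∣≤n S))) (S , refl , clique))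

degree≤Δ : ∀ {n} (G : Graph n) u → degree G u ≤ Δ G
degree≤Δ {n} G u = All.lookup (xs≤max 0 (List.map (degree G) (allFin n)))
  (List.∈-map⁺ (degree G) (List.∈-allFin u))

-- A nonempty clique lies in the closed neighbourhood of any of its members.
clique≤1+Δ : ∀ {n} (G : Graph n) S → IsClique G S → ∣ S ∣ ≤ suc (Δ G)
clique≤1+Δ {n} G S clique with Subset.nonempty? S
... | no empty = ℕ.≤-trans (ℕ.≤-reflexive
  (trans (cong ∣_∣ (Subset.Empty-unique empty)) (Subset.∣⊥∣≡0 n))) z≤n
... | yes (u , u∈S) = begin
  ∣ S ∣                  ≤⟨ Subset.p⊆q⇒∣p∣≤∣q∣ S⊆ ⟩
  ∣ ⁅ u ⁆ ∪ N ∣          ≤⟨ ∣p∪q∣≤∣p∣+∣q∣ ⁅ u ⁆ N ⟩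
  (∣ ⁅ u ⁆ ∣) + (∣ N ∣)  ≡⟨ cong (_+ ∣ N ∣) (Subset.∣⁅x⁆∣≡1 u) ⟩
  suc ∣ N ∣              ≡⟨ cong suc (length-filter-tabulate (adj? G u) id) ⟨
  suc (degree G u)       ≤⟨ s≤s (degree≤Δ G u) ⟩
  suc (Δ G)              ∎
  where
  open ℕ.≤-Reasoning
  N = subset (adj? G u)
  S⊆ : S Subset.⊆ ⁅ u ⁆ ∪ N
  S⊆ {v} v∈S with u Fin.≟ v
  ... | yes refl = Subset.x∈p∪q⁺ (inj₁ (Subset.x∈⁅x⁆ u))
  ... | no u≢v   = Subset.x∈p∪q⁺ (inj₂ (∈-subset⁺ (adj? G u) (clique u v u∈S v∈S u≢v)))

ω≤1+Δ : ∀ {n} (G : Graph n) → ω G ≤ suc (Δ G)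
ω≤1+Δ {n} G = max≤v⁺ z≤n (All.map (λ { (S , refl , clique) → clique≤1+Δ G S clique })
  (All.all-filter (hasClique? G) (upTo (suc n))))

-- Interval orders

-- Fishburn's characterisation: irreflexive and free of `2 + 2`. Transitivity is the case `c = b`.
IsIntervalOrder : ∀ {n} → Rel (Fin n) 0ℓ → Set
IsIntervalOrder _≺_ =
  (∀ a → ¬ a ≺ a) × (∀ a b c d → a ≺ b → c ≺ d → a ≺ d ⊎ c ≺ b)

isIntervalOrder? : ∀ {n} {_≺_ : Rel (Fin n) 0ℓ} → Binary.Decidable _≺_ → Dec (IsIntervalOrder _≺_)
isIntervalOrder? _≺?_ =
  Fin.all? (λ a → ¬? (a ≺? a)) ×-dec
  Fin.all? (λ a → Fin.all? λ b → Fin.all? λ c → Fin.all? λ d →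
    (a ≺? b) →-dec ((c ≺? d) →-dec ((a ≺? d) ⊎-dec (c ≺? b))))

module IntervalRepresentation {n} {_≺_ : Rel (Fin n) 0ℓ} (_≺?_ : Binary.Decidable _≺_)
  (isIntervalOrder : IsIntervalOrder _≺_) where

  -- Predecessor sets of an interval order form a chain under inclusion, so their
  -- sizes can serve as left endpoints.
  predecessors : Fin n → Subset n
  predecessors v = subset (_≺? v)

  left right : Fin n → ℕ
  left v  = ∣ predecessors v ∣
  -- The interval of `u` must reach the left end of every `v` not above `u`, and is made no longer
  -- than that.
  right u = max 0 (List.map left (filter (λ v → ¬? (u ≺? v)) (allFin n)))

  ⊀⇒left≤right : ∀ {u v} → ¬ u ≺ v → left v ≤ right u
  ⊀⇒left≤right {u} {v} u⊀v = All.lookup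
    (xs≤max 0 (List.map left (filter (λ v → ¬? (u ≺? v)) (allFin n))))
    (List.∈-map⁺ left (List.∈-filter⁺ (λ v → ¬? (u ≺? v)) (List.∈-allFin v) u⊀v))

  left≤right : ∀ u → left u ≤ right u
  left≤right u = ⊀⇒left≤right (proj₁ isIntervalOrder u)

  -- From `x ≺ w` and `u ≺ v` follows `x ≺ v`, as `u ≺ w` is excluded. So the predecessors of `w`
  -- are among those of `v`, and `u` makes the inclusion strict.
  left-mono : ∀ {u v w} → u ≺ v → ¬ u ≺ w → left w < left v
  left-mono {u} {v} {w} u≺v u⊀w = Subset.p⊂q⇒∣p∣<∣q∣
    ( (λ {x} x∈ → ∈-subset⁺ (_≺? v)
        ([ id , (λ u≺w → contradiction u≺w u⊀w) ]′
          (proj₂ isIntervalOrder x w u v (∈-subset⁻ (_≺? w) x∈) u≺v)))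
    , u , ∈-subset⁺ (_≺? v) u≺v , u⊀w ∘ ∈-subset⁻ (_≺? w))

  ≺⇒right<left : ∀ {u v} → u ≺ v → right u < left v
  ≺⇒right<left {u} {v} u≺v = max<v⁺
    -- The default `0` of `max` must lie below `left v` too; irreflexivity at `u` gives
    -- `left u < left v`, which suffices.
    (ℕ.≤-<-trans z≤n (left-mono u≺v (proj₁ isIntervalOrder u)))
    (All.map⁺ (All.map (left-mono u≺v) (All.all-filter (λ v → ¬? (u ≺? v)) (allFin n))))

-- Realizers

-- R i u v is to be read as: in coordinate i, box u lies strictly below box v.

IsRealizer : ∀ {n c} → Graph n → (Fin c → Rel (Fin n) 0ℓ) → Set
IsRealizer G R =
  (∀ i → IsIntervalOrder (R i)) ×
  (∀ i u v → R i u v → ¬ Adj G u v) ×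
  (∀ u v → u ≢ v → ¬ Adj G u v → ∃ λ i → R i u v ⊎ R i v u)

Realizer : ∀ {n} → Graph n → ℕ → Set₁
Realizer {n} G c = ∃ λ (R : Fin c → Rel (Fin n) 0ℓ) → (∀ i → Binary.Decidable (R i)) × IsRealizer G R

isRealizer? : ∀ {n c} (G : Graph n) {R : Fin c → Rel (Fin n) 0ℓ} →
  (∀ i → Binary.Decidable (R i)) → Dec (IsRealizer G R)
isRealizer? G R? =
  Fin.all? (λ i → isIntervalOrder? (R? i)) ×-dec
  Fin.all? (λ i → Fin.all? λ u → Fin.all? λ v → R? i u v →-dec ¬? (adj? G u v)) ×-dec
  Fin.all? (λ u → Fin.all? λ v → ¬? (u Fin.≟ v) →-dec (¬? (adj? G u v) →-dec
    Fin.any? λ i → R? i u v ⊎-dec R? i v u))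

isRealizer-resp-⇔ : ∀ {n c} (G : Graph n) {R S : Fin c → Rel (Fin n) 0ℓ} →
  (∀ i u v → R i u v ⇔ S i u v) → IsRealizer G R → IsRealizer G S
isRealizer-resp-⇔ G R⇔S (orders , sound , complete) =
  (λ i → (λ a → proj₁ (orders i) a ∘ from (R⇔S i a a))
       , (λ a b c d ab cd → Sum.map (to (R⇔S i a d)) (to (R⇔S i c b))
           (proj₂ (orders i) a b c d (from (R⇔S i a b) ab) (from (R⇔S i c d) cd))))
  , (λ i u v → sound i u v ∘ from (R⇔S i u v))
  , (λ u v u≢v ¬uv → let (i , uv⊎vu) = complete u v u≢v ¬uv in
       i , Sum.map (to (R⇔S i u v)) (to (R⇔S i v u)) uv⊎vu)

-- Every family of decidable relations has such a finite code, which makes realizers searchable.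
matrixRel : ∀ {n c} → Vec (Vec (Subset n) n) c → Fin c → Rel (Fin n) 0ℓ
matrixRel M i u v = v ∈ Vec.lookup (Vec.lookup M i) u

matrixRel? : ∀ {n c} (M : Vec (Vec (Subset n) n) c) i → Binary.Decidable (matrixRel M i)
matrixRel? M i u v = v Subset.∈? Vec.lookup (Vec.lookup M i) u

module _ {n c} {R : Fin c → Rel (Fin n) 0ℓ} (R? : ∀ i → Binary.Decidable (R i)) where

  matrix : Vec (Vec (Subset n) n) c
  matrix = Vec.tabulate λ i → Vec.tabulate λ u → subset (R? i u)

  lookup-matrix : ∀ i u → Vec.lookup (Vec.lookup matrix i) u ≡ subset (R? i u)
  lookup-matrix i u = trans
    (cong (λ row → Vec.lookup row u) (Vec.lookup∘tabulate (λ i → Vec.tabulate λ u → subset (R? i u)) i))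
    (Vec.lookup∘tabulate (λ u → subset (R? i u)) u)

  matrixRel-matrix : ∀ i u v → R i u v ⇔ matrixRel matrix i u v
  matrixRel-matrix i u v = mk⇔
    (λ uv → subst (v ∈_) (sym (lookup-matrix i u)) (∈-subset⁺ (R? i u) uv))
    (λ v∈ → ∈-subset⁻ (R? i u) (subst (v ∈_) (lookup-matrix i u) v∈))

realizer? : ∀ {n} (G : Graph n) c → Dec (Realizer G c)
realizer? G c = map′
  (λ (M , realizes) → matrixRel M , matrixRel? M , realizes)
  (λ (R , R? , realizes) → matrix R? , isRealizer-resp-⇔ G (matrixRel-matrix R?) realizes)
  (anyVec? (anyVec? Subset.anySubset?) λ M → isRealizer? G (matrixRel? M))

-- Realizers and box representations

realizer⇒box : ∀ {n c} (G : Graph n) → Realizer G c → HasBoxRepresentation G c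
realizer⇒box {n} {c} G (R , R? , orders , sound , complete) = box , λ u≢v → mk⇔ meet⁺ (meet⁻ u≢v)
  where
  module I i = IntervalRepresentation (R? i) (orders i)

  point : ℕ → ℝ
  point m = 0ℝ ⊞ + m

  point-mono : ∀ {l m} → l ≤ m → point l Defs.≤ point m
  point-mono l≤m = lower-⊆ (⊞-monoʳ 0ℝ (ℤ.+≤+ l≤m))

  point-cancel : ∀ {l m} → point l ⊑ point m → l ≤ m
  point-cancel l⊑m = ℤ.drop‿+≤+ (0⊞-cancel l⊑m)

  box : Fin n → Fin c → Interval
  box u i = record
    { lo    = point (I.left i u)
    ; hi    = point (I.right i u)
    ; lo≤hi = point-mono (I.left≤right i u)
    }

  meet⁺ : ∀ {u v} → Adj G u v → boxPoints (box u) ≬ boxPoints (box v)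
  meet⁺ {u} {v} uv =
    -- The larger left end is a common point: by soundness no `R i` orders two adjacent vertices.
    (λ i → point (I.left i u ⊔ I.left i v)) ,
    (λ i → point-mono (ℕ.m≤m⊔n (I.left i u) (I.left i v)) ,
           point-mono (ℕ.⊔-lub (I.left≤right i u) (I.⊀⇒left≤right i λ u≺v → sound i u v u≺v uv))) ,
    (λ i → point-mono (ℕ.m≤n⊔m (I.left i u) (I.left i v)) ,
           point-mono (ℕ.⊔-lub (I.⊀⇒left≤right i λ v≺u → sound i v u v≺u (symm G uv)) (I.left≤right i v)))

  separated : ∀ {u v} p i → boxPoints (box u) p → boxPoints (box v) p → ¬ R i u v
  separated p i p∈u p∈v u≺v = ℕ.<⇒≱ (I.≺⇒right<left i u≺v)
    (point-cancel (⊑-trans {y = p i} ⟪ proj₁ (p∈v i) ⟫ ⟪ proj₂ (p∈u i) ⟫))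

  meet⁻ : ∀ {u v} → u ≢ v → boxPoints (box u) ≬ boxPoints (box v) → Adj G u v
  meet⁻ {u} {v} u≢v (p , p∈u , p∈v) = decidable-stable (adj? G u v) λ ¬uv →
    let (i , u≺v⊎v≺u) = complete u v u≢v ¬uv in
    [ separated p i p∈u p∈v , separated p i p∈v p∈u ]′ u≺v⊎v≺u

-- The larger left end lies in both intervals. Comparability of the left ends is a hypothesis
-- because it is available only under double negation.
common-point : ∀ {a b c d} → a ⊑ b → c ⊑ d → a ⊑ d → c ⊑ b → a ⊑ c ⊎ c ⊑ a →
  ∃ λ p → (a ⊑ p × p ⊑ b) × (c ⊑ p × p ⊑ d)
common-point {c = c} a⊑b c⊑d a⊑d c⊑b (inj₁ a⊑c) = c , (a⊑c , c⊑b) , (⊑-refl , c⊑d)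
common-point {a}     a⊑b c⊑d a⊑d c⊑b (inj₂ c⊑a) = a , (⊑-refl , a⊑b) , (c⊑a , a⊑d)

intervals⇒isIntervalOrder : ∀ {n} (left right : Fin n → ℝ) →
  (∀ u → left u ⊑ right u) → (∀ u v → Dec (left v ⊑ right u)) →
  IsIntervalOrder (λ u v → ¬ left v ⊑ right u)
intervals⇒isIntervalOrder left right left⊑right meets? =
  (λ a a≺a → a≺a (left⊑right a)) , ferrers
  where
  ferrers : ∀ a b c d → ¬ left b ⊑ right a → ¬ left d ⊑ right c →
    ¬ left d ⊑ right a ⊎ ¬ left b ⊑ right c
  ferrers a b c d a≺b c≺d with meets? a d | meets? c b
  ... | no a≺d | _ = inj₁ a≺d
  ... | yes _  | no c≺b = inj₂ c≺b
  -- Here `right a ⊑ right c` would give `left d ⊑ right c`, against `c≺d`. Hence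
  -- `right c ⊑ right a`, so `left b ⊑ right a`, against `a≺b`.
  ... | yes d⊑a | yes b⊑c =
    contradiction (⊑-trans b⊑c (⋢⇒⊒ λ a⊑c → c≺d (⊑-trans d⊑a a⊑c))) a≺b

-- The projections to each coordinate supply the orders. The double negation pays for deciding the
-- finitely many comparisons of their ends.
box⇒¬¬realizer : ∀ {n c} (G : Graph n) → HasBoxRepresentation G c → ¬ ¬ Realizer G c
box⇒¬¬realizer {n} {c} G (box , represents) ¬realizer =
  ¬¬-∀ (λ i → ¬¬-∀ λ u → ¬¬-∀ λ v → ¬¬-excluded-middle) λ meets? →
    ¬realizer
      ( R , (λ i u v → ¬? (meets? i u v))
      , (λ i → intervals⇒isIntervalOrder (λ u → lo (box u i)) (λ u → hi (box u i))
           (λ u → ⟪ lo≤hi (box u i) ⟫) (meets? i))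
      , sound , complete meets?)
  where
  R : Fin c → Rel (Fin n) 0ℓ
  R i u v = ¬ lo (box v i) ⊑ hi (box u i)

  sound : ∀ i u v → R i u v → ¬ Adj G u v
  sound i u v u≺v uv with u Fin.≟ v
  ... | yes refl = u≺v ⟪ lo≤hi (box u i) ⟫
  ... | no u≢v = let (p , p∈u , p∈v) = to (represents u≢v) uv in
    u≺v (⊑-trans {y = p i} ⟪ proj₁ (p∈v i) ⟫ ⟪ proj₂ (p∈u i) ⟫)

  module _ (meets? : ∀ i u v → Dec (lo (box v i) ⊑ hi (box u i))) where

    complete : ∀ u v → u ≢ v → ¬ Adj G u v → ∃ λ i → R i u v ⊎ R i v u
    -- Given `meets?` the conclusion is decidable, so its negation may be refuted: without a
    -- separating coordinate, the common points of the projections assemble into a common point of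
    -- the boxes.
    complete u v u≢v ¬uv = decidable-stable
      (Fin.any? λ i → ¬? (meets? i u v) ⊎-dec ¬? (meets? i v u)) λ ¬separated →
      ¬¬-∀ (λ i → ¬¬⊑-total (lo (box u i)) (lo (box v i))) λ total →
      let meet i = decidable-stable (meets? i u v) (λ u≺v → ¬separated (i , inj₁ u≺v))
          meet′ i = decidable-stable (meets? i v u) (λ v≺u → ¬separated (i , inj₂ v≺u))
          common i = common-point ⟪ lo≤hi (box u i) ⟫ ⟪ lo≤hi (box v i) ⟫ (meet′ i) (meet i) (total i)
      in ¬uv (from (represents u≢v)
        ( (λ i → proj₁ (common i))
        , (λ i → let (_ , (l , r) , _) = common i in lower-⊆ l , lower-⊆ r)
        , (λ i → let (_ , _ , (l , r)) = common i in lower-⊆ l , lower-⊆ r)))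

-- Circular arcs

module ⊑-Reasoning = Relation.Binary.Reasoning.Base.Single _⊑_ ⊑-refl ⊑-trans

∈-arc⁺ : ∀ A {p} k → start A ⊑ p ⊞ k → p ⊞ k ⊑ end A → arcPoints A p
∈-arc⁺ A k s⊑p p⊑e = k , ⊑-⊞⁻ s⊑p , ⊞-⊑⁻ p⊑e

∈-arc⁻ : ∀ A {p} → arcPoints A p → ∃ λ k → start A ⊑ p ⊞ k × p ⊞ k ⊑ end A
∈-arc⁻ A (k , s≤p , p≤e) = k , ⊑-⊞⁺ s≤p , ⊞-⊑⁺ p≤e

-- An arc A missing 0 whose start lies in [k , k + 1] stays in that interval, so
-- the lift of a common point of A and B to A cannot exceed its lift to B.
meet⇒shifted-⊑ : ∀ A B {k l p} → ¬ arcPoints A 0ℝ → start A ⊑ 0ℝ ⊞ (k ℤ.+ 1ℤ) →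
  0ℝ ⊞ l ⊑ start B → arcPoints A p → arcPoints B p → start A ⊞ ℤ.- k ⊑ end B ⊞ ℤ.- l
meet⇒shifted-⊑ A B {k} {l} {p} 0∉A A⊑k+1 l⊑B p∈A p∈B
  with a , sA⊑p , p⊑eA ← ∈-arc⁻ A p∈A | b , sB⊑p , p⊑eB ← ∈-arc⁻ B p∈B
  with a ℤ.- k ℤ.≤? b ℤ.- l
... | yes a-k≤b-l = begin
  start A ⊞ ℤ.- k    ∼⟨ ⊞-monoˡ (ℤ.- k) sA⊑p ⟩
  p ⊞ a ⊞ ℤ.- k      ∼⟨ ⊞-assoc-⊑ p a (ℤ.- k) ⟩
  p ⊞ (a ℤ.- k)      ∼⟨ ⊞-monoʳ p a-k≤b-l ⟩
  p ⊞ (b ℤ.- l)      ∼⟨ ⊞-assoc-⊒ p b (ℤ.- l) ⟩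
  p ⊞ b ⊞ ℤ.- l      ∼⟨ ⊞-monoˡ (ℤ.- l) p⊑eB ⟩
  end B ⊞ ℤ.- l      ∎
  where open ⊑-Reasoning hiding (start)
... | no a-k≰b-l = contradiction (∈-arc⁺ A (k ℤ.+ 1ℤ) A⊑k+1 k+1⊑eA) 0∉A
  where
  open ⊑-Reasoning hiding (start)
  -- Translation by `c` takes `l` to `k + 1`. Since `b + c ≤ a`, the integer `k + 1` is at most
  -- `p ⊞ b ⊞ c`, hence at most `p ⊞ a` and `end A`; so 0 would lie on `A`.
  c : ℤ
  c = k ℤ.+ 1ℤ ℤ.- l

  l+c≡k+1 : ∀ k l → k ℤ.+ 1ℤ ≡ l ℤ.+ (k ℤ.+ 1ℤ ℤ.- l)
  l+c≡k+1 = solve-∀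

  b+c≡1+b-l+k : ∀ b k l → 1ℤ ℤ.+ (b ℤ.- l) ℤ.+ k ≡ b ℤ.+ (k ℤ.+ 1ℤ ℤ.- l)
  b+c≡1+b-l+k = solve-∀

  a-k+k≡a : ∀ a k → a ℤ.- k ℤ.+ k ≡ a
  a-k+k≡a = solve-∀

  b+c≤a : b ℤ.+ c ℤ.≤ a
  b+c≤a = subst₂ ℤ._≤_ (b+c≡1+b-l+k b k l) (a-k+k≡a a k)
    (ℤ.+-monoˡ-≤ k (ℤ.i<j⇒suc[i]≤j (ℤ.≰⇒> a-k≰b-l)))

  k+1⊑eA : 0ℝ ⊞ (k ℤ.+ 1ℤ) ⊑ end A
  k+1⊑eA = begin
    0ℝ ⊞ (k ℤ.+ 1ℤ)   ≡⟨ cong (0ℝ ⊞_) (l+c≡k+1 k l) ⟩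
    0ℝ ⊞ (l ℤ.+ c)    ∼⟨ ⊞-assoc-⊒ 0ℝ l c ⟩
    0ℝ ⊞ l ⊞ c        ∼⟨ ⊞-monoˡ c l⊑B ⟩
    start B ⊞ c       ∼⟨ ⊞-monoˡ c sB⊑p ⟩
    p ⊞ b ⊞ c         ∼⟨ ⊞-assoc-⊑ p b c ⟩
    p ⊞ (b ℤ.+ c)     ∼⟨ ⊞-monoʳ p b+c≤a ⟩
    p ⊞ a             ∼⟨ p⊑eA ⟩
    end A             ∎

shifted⇒∈-arc : ∀ A {p} k → start A ⊞ ℤ.- k ⊑ p → p ⊑ end A ⊞ ℤ.- k → arcPoints A p
shifted⇒∈-arc A k s⊑p p⊑e = ∈-arc⁺ A k
  (⊑-trans (⊞-cancel-⊒ (start A) k) (⊞-monoˡ k s⊑p))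
  (⊑-trans (⊞-monoˡ k p⊑e) (⊞-cancel-⊑ (end A) k))

-- The order of the intervals [0,0] for w, [0,1] for its neighbours and [1,1] for
-- all other vertices.
Star : ∀ {n} → Graph n → Fin n → Rel (Fin n) 0ℓ
Star G w u v = u ≡ w × u ≢ v × ¬ Adj G u v

star? : ∀ {n} (G : Graph n) w → Binary.Decidable (Star G w)
star? G w u v = (u Fin.≟ w) ×-dec ¬? (u Fin.≟ v) ×-dec ¬? (adj? G u v)

star-isIntervalOrder : ∀ {n} (G : Graph n) w → IsIntervalOrder (Star G w)
star-isIntervalOrder G w =
  (λ { a (_ , a≢a , _) → a≢a refl }) ,
  (λ { a b c d (refl , _) (refl , c≢d , ¬cd) → inj₁ (refl , c≢d , ¬cd) })

-- Vertices outside `P` become incomparable to all others, as if their intervals covered the whole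
-- line.
Restrict : ∀ {n} → Pred (Fin n) 0ℓ → Rel (Fin n) 0ℓ → Rel (Fin n) 0ℓ
Restrict P _≺_ u v = P u × P v × u ≺ v

restrict-isIntervalOrder : ∀ {n} {P : Pred (Fin n) 0ℓ} {_≺_} →
  IsIntervalOrder _≺_ → IsIntervalOrder (Restrict P _≺_)
restrict-isIntervalOrder (irrefl , ferrers) =
  (λ { a (_ , _ , a≺a) → irrefl a a≺a }) ,
  (λ { a b c d (Pa , Pb , a≺b) (Pc , Pd , c≺d) →
    Sum.map (λ a≺d → Pa , Pd , a≺d) (λ c≺b → Pc , Pb , c≺b) (ferrers a b c d a≺b c≺d) })

module _ {n} (G : Graph n) {K : Pred (Fin n) 0ℓ} (K? : Decidable K)
  {_≺_ : Rel (Fin n) 0ℓ} (_≺?_ : Binary.Decidable _≺_) (isIntervalOrder : IsIntervalOrder _≺_)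
  (sound : ∀ u v → ¬ K u → ¬ K v → u ≺ v → ¬ Adj G u v)
  (complete : ∀ u v → u ≢ v → ¬ K u → ¬ K v → ¬ Adj G u v → u ≺ v ⊎ v ≺ u)
  where

  private
    ks : List (Fin n)
    ks = filter K? (allFin n)

    R : Fin (suc (length ks)) → Rel (Fin n) 0ℓ
    R zero    = Restrict (λ u → ¬ K u) _≺_
    R (suc i) = Star G (List.lookup ks i)

    star-of : ∀ u → K u → ∃ λ i → u ≡ List.lookup ks i
    star-of u Ku = let u∈ks = List.∈-filter⁺ K? (List.∈-allFin u) Ku in
      Any.index u∈ks , Any.lookup-index u∈ks

    complete′ : ∀ u v → u ≢ v → ¬ Adj G u v → ∃ λ i → R i u v ⊎ R i v u
    complete′ u v u≢v ¬uv with K? u | K? v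
    ... | yes Ku | _      = let (i , u≡i) = star-of u Ku in suc i , inj₁ (u≡i , u≢v , ¬uv)
    ... | no _   | yes Kv = let (i , v≡i) = star-of v Kv in suc i , inj₂ (v≡i , u≢v ∘ sym , ¬uv ∘ symm G)
    ... | no ¬Ku | no ¬Kv = zero , Sum.map (λ u≺v → ¬Ku , ¬Kv , u≺v) (λ v≺u → ¬Kv , ¬Ku , v≺u)
                                     (complete u v u≢v ¬Ku ¬Kv ¬uv)

  -- Coordinate `zero` handles non-adjacent pairs outside `K`. Any other non-adjacent pair has a
  -- member in `K`, whose star separates it.
  interval-outside⇒realizer : Realizer G (suc ∣ subset K? ∣)
  interval-outside⇒realizer = subst (Realizer G ∘ suc) (length-filter-tabulate K? id)
    ( R
    , (λ { zero u v    → ¬? (K? u) ×-dec ¬? (K? v) ×-dec (u ≺? v)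
         ; (suc i) u v → star? G (List.lookup ks i) u v })
    , (λ { zero → restrict-isIntervalOrder isIntervalOrder
         ; (suc i) → star-isIntervalOrder G (List.lookup ks i) })
    , (λ { zero u v (¬Ku , ¬Kv , u≺v) → sound u v ¬Ku ¬Kv u≺v
         ; (suc i) u v (_ , _ , ¬uv) → ¬uv })
    , complete′)

-- Three finite families are chosen under the double negation: which arcs contain 0, an integer part
-- of each start, and the comparisons of the arcs shifted by these integers. Arcs through 0 are
-- shifted as well, but the shifted order need only match non-adjacency outside `K`.
circularArc⇒¬¬realizer : ∀ {n} (G : Graph n) → IsCircularArcGraph G →
  ¬ ¬ ∃ λ c → c ≤ suc (ω G) × Realizer G c
circularArc⇒¬¬realizer {n} G (arc , _ , represents) ¬realizer =
  ¬¬-∀ (λ u → ¬¬-excluded-middle) λ K? →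
  ¬¬-∀ (λ u → ¬¬floor (start (arc u))) λ floors →
  ¬¬-∀ (λ u → ¬¬-∀ λ v → ¬¬-excluded-middle) λ meets? →
  ¬realizer
    ( suc ∣ subset K? ∣
    , s≤s (clique≤ω G (subset K?) (clique K?))
    , interval-outside⇒realizer G K? (λ u v → ¬? (meets? u v))
        (intervals⇒isIntervalOrder (left floors) (right floors) (left⊑right floors) meets?)
        (sound floors) (complete floors meets?))
  where
  K : Pred (Fin n) 0ℓ
  K u = arcPoints (arc u) 0ℝ

  clique : (K? : Decidable K) → IsClique G (subset K?)
  clique K? u v u∈ v∈ u≢v = from (represents u≢v) (0ℝ , ∈-subset⁻ K? u∈ , ∈-subset⁻ K? v∈)

  module _ (floors : ∀ u → ∃ λ k → 0ℝ ⊞ k ⊑ start (arc u) × start (arc u) ⊑ 0ℝ ⊞ (k ℤ.+ 1ℤ)) where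

    k : Fin n → ℤ
    k u = proj₁ (floors u)

    left right : Fin n → ℝ
    left u  = start (arc u) ⊞ ℤ.- k u
    right u = end (arc u) ⊞ ℤ.- k u

    left⊑right : ∀ u → left u ⊑ right u
    left⊑right u = ⊞-monoˡ (ℤ.- k u) ⟪ start≤end (arc u) ⟫

    sound : ∀ u v → ¬ K u → ¬ K v → ¬ left v ⊑ right u → ¬ Adj G u v
    sound u v ¬Ku ¬Kv u≺v uv with u Fin.≟ v
    ... | yes refl = u≺v (left⊑right u)
    ... | no u≢v   = let (p , p∈u , p∈v) = to (represents u≢v) uv in
      u≺v (meet⇒shifted-⊑ (arc v) (arc u) {p = p} ¬Kv
        (proj₂ (proj₂ (floors v))) (proj₁ (proj₂ (floors u))) p∈v p∈u)

    complete : (∀ u v → Dec (left v ⊑ right u)) → ∀ u v → u ≢ v → ¬ K u → ¬ K v → ¬ Adj G u v →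
      ¬ left v ⊑ right u ⊎ ¬ left u ⊑ right v
    complete meets? u v u≢v _ _ ¬uv with meets? u v | meets? v u
    ... | no u≺v | _      = inj₁ u≺v
    ... | yes _  | no v≺u = inj₂ v≺u
    ... | yes v⊑u | yes u⊑v = contradiction
      (λ total → let (p , (l , r) , (l′ , r′)) =
                       common-point (left⊑right u) (left⊑right v) u⊑v v⊑u total in
        ¬uv (from (represents u≢v)
          (p , shifted⇒∈-arc (arc u) (k u) l r , shifted⇒∈-arc (arc v) (k v) l′ r′)))
      (¬¬⊑-total (left u) (left v))

-- Least dimension and the final bounds

LeastUpTo : ∀ {ℓ} → Pred ℕ ℓ → Pred ℕ ℓ
LeastUpTo P m = ∃ λ b → b ≤ m × P b × (∀ c → c < b → ¬ P c)

least : ∀ {ℓ} {P : Pred ℕ ℓ} → Decidable P → ∀ m → P m → LeastUpTo P m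
least {P = P} P? = <-rec (λ m → P m → LeastUpTo P m) λ m rec Pm → step rec Pm (ℕ.anyUpTo? P? m)
  where
  step : ∀ {m} → (∀ {l} → l < m → P l → LeastUpTo P l) → P m →
    Dec (∃ λ l → l < m × P l) → LeastUpTo P m
  step rec Pm (yes (l , l<m , Pl)) =
    let (b , b≤l , rest) = rec l<m Pl in b , ℕ.≤-trans b≤l (ℕ.<⇒≤ l<m) , rest
  step rec Pm (no ¬smaller)        =
    _ , ℕ.≤-refl , Pm , λ c c<m Pc → ¬smaller (c , c<m , Pc)

theorem6 : (n : ℕ) (G : Graph n) → IsCircularArcGraph G →
    ∃ λ (b : ℕ) → IsBoxicity G b × b ≤ 2 * ω G + 1 × 2 * ω G + 1 ≤ 2 * Δ G + 3
theorem6 n G circularArc =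
  -- A bounded search for a decidable property is decidable, so the double negation can be removed
  -- here.
  let (c , c<2+ω , realizer) = decidable-stable (ℕ.anyUpTo? (realizer? G) (2 + ω G)) λ ¬realizer →
        circularArc⇒¬¬realizer G circularArc λ (c , c≤1+ω , realizer) →
        ¬realizer (c , s≤s c≤1+ω , realizer)
      (b , b≤c , realizer-b , minimal) = least (realizer? G) c realizer
  in b
   -- A realizer known only up to double negation still contradicts minimality, which is a negative
   -- statement.
   , (realizer⇒box G realizer-b , λ d box → ℕ.≮⇒≥ λ d<b → box⇒¬¬realizer G box (minimal d d<b))
   , (begin
       b              ≤⟨ b≤c ⟩
       c              ≤⟨ ℕ.≤-pred c<2+ω ⟩
       suc (ω G)      ≡⟨ ℕ.+-comm 1 (ω G) ⟩
       -- The construction gives `ω G + 1`; the bound is relaxed to the stated one.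
       ω G + 1        ≤⟨ ℕ.+-monoˡ-≤ 1 (ℕ.m≤n*m (ω G) 2) ⟩
       2 * ω G + 1    ∎)
   , (begin
       -- Doubling `ω G ≤ 1 + Δ G` contributes 2 to the constant 3.
       2 * ω G + 1          ≤⟨ ℕ.+-monoˡ-≤ 1 (ℕ.*-monoʳ-≤ 2 (ω≤1+Δ G)) ⟩
       2 * suc (Δ G) + 1    ≡⟨ cong (_+ 1) (ℕ.*-suc 2 (Δ G)) ⟩
       2 + 2 * Δ G + 1      ≡⟨ ℕ.+-comm (2 + 2 * Δ G) 1 ⟩
       3 + 2 * Δ G          ≡⟨ ℕ.+-comm 3 (2 * Δ G) ⟩
       2 * Δ G + 3          ∎)
  where open ℕ.≤-Reasoning
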